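{- Let $m,n,k$ be positive integers. (i) If $n\in\{2,3,4\}$ and $k\leq (n+1)m$, then $S_m(n,k)$ is word-representable. Moreover, $S_m(2,k)$ is not word-representable for every $k\geq 3m+1$. (ii) If $n\geq 5$ and $k\leq 2mn$, then $S_m(n,k)$ is word-representable.
   Context: For a positive integer $k$ let $A(k)=\{0,1,\ldots,k-1\}$. For integers $n\ge 2$ and $m\ge 0$ let $$A^n_m(k)=\{x_1x_2\ldots x_n : x_i\in A(k)\text{ for } 1\le i\le n \text{ and } |x_i-x_{i+1}|\ge m \text{ for } 1\le i\le n-1\},$$ a set of words of length $n$; in particular $A^n_0(k)$ is the set of all words of length $n$ over $A(k)$. The de Bruijn graph $B(n,k)$ is the directed graph with vertex set $A^n_0(k)$ having an arc from $x_1x_2\ldots x_n$ to $y_1y_2\ldots y_n$ if and only if $x_{i+1}=y_i$ for all $i\in\{1,\ldots,n-1\}$. The simplified de Bruijn graph $S(n,k)$ is the simple undirected graph obtained from $B(n,k)$ by removing orientations and loops and replacing multiple edges between a pair of vertices by a single edge. $S_m(n,k)$ denotes the subgraph of $S(n,k)$ induced by the vertex set $A^n_m(k)$. Word-representability: two distinct letters $x$ and $y$ alternate in a word $w$ if, after deleting from $w$ all letters other than the copies of $x$ and $y$, one obtains either a word $xyxy\cdots$ or a word $yxyx\cdots$ (of even or odd length). A simple graph $G=(V,E)$ is word-representable if there exists a (finite) word $w$ over the alphabet $V$, in which every letter of $V$ occurs, such that for all $x\ne y$ in $V$, the letters $x$ and $y$ alternate in $w$ if and only if $xy\in E$. -}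

module Defs where

open import Data.Fin.Base using (Fin; toℕ)
open import Data.Fin.Properties using () renaming (_≟_ to _≟ᶠ_)
open import Data.List.Base using (List; []; _∷_; filter)
open import Data.List.Membership.Propositional using (_∈_)
open import Data.Nat.Base using (ℕ; zero; suc; _≤_; ∣_-_∣)
open import Data.Product.Base using (_×_; _,_; ∃-syntax; Σ-syntax)
open import Data.Refinement.Base using (Refinement; value)
import Data.Refinement.Properties as Refinement
open import Data.Sum.Base using (_⊎_; swap)
open import Data.Vec.Base using (Vec; lookup)
open import Data.Vec.Properties using (≡-dec)
open import Data.Vec.Relation.Unary.Linked using (Linked)
open import Function.Base using (_on_)
open import Function.Bundles using (_⇔_)
open import Level using (0ℓ)
open import Relation.Binary.Core using (Rel)
open import Relation.Binary.Definitions using (DecidableEquality; Irreflexive; Symmetric)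
open import Relation.Binary.PropositionalEquality using (_≡_; _≢_; cong; sym)
open import Relation.Nullary.Decidable using (_⊎-dec_)
open import Relation.Unary using (Pred)

-- Decidable equality of vertices is what allows words over the vertex set
-- to be restricted to two letters.  Finiteness is not imposed here: it is
-- forced on any word-representable graph by the definition below.
record SimpleGraph : Set₁ where
  field
    Vertex : Set
    _≟_    : DecidableEquality Vertex
    _~_    : Rel Vertex 0ℓ
    irrefl : Irreflexive _≡_ _~_
    symm   : Symmetric _~_

simplify : {V : Set} → DecidableEquality V → Rel V 0ℓ → SimpleGraph
simplify {V} _≟_ _⟶_ = record
  { Vertex = V
  ; _≟_    = _≟_
  ; _~_    = λ x y → x ≢ y × (x ⟶ y ⊎ y ⟶ x)
  ; irrefl = λ x≡y (x≢y , _) → x≢y x≡y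
  ; symm   = λ (x≢y , e) → (λ y≡x → x≢y (sym y≡x)) , swap e
  }

-- Membership proofs are irrelevant, so a vertex of the induced subgraph is
-- determined by the underlying vertex of G.
induced : (G : SimpleGraph) → Pred (SimpleGraph.Vertex G) 0ℓ → SimpleGraph
induced G P = record
  { Vertex = Refinement Vertex P
  ; _≟_    = Refinement._≟_ _≟_
  ; _~_    = _~_ on value
  ; irrefl = λ x≡y → irrefl (cong value x≡y)
  ; symm   = symm
  }
  where open SimpleGraph G

alternating : {A : Set} → A → A → ℕ → List A
alternating x y zero    = []
alternating x y (suc ℓ) = x ∷ alternating y x ℓ

module _ {A : Set} (_≟_ : DecidableEquality A) where

  restrict : A → A → List A → List A
  restrict x y = filter (λ z → (z ≟ x) ⊎-dec (z ≟ y))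

  Alternate : List A → A → A → Set
  Alternate w x y = ∃[ ℓ ] (restrict x y w ≡ alternating x y ℓ
                          ⊎ restrict x y w ≡ alternating y x ℓ)

WordRepresentable : SimpleGraph → Set
WordRepresentable G =
  Σ[ w ∈ List Vertex ]
    (∀ x → x ∈ w) × (∀ x y → x ≢ y → Alternate _≟_ w x y ⇔ x ~ y)
  where open SimpleGraph G

-- The set Aⁿ₀(k); the alphabet A(k) is Fin k.
Word : ℕ → ℕ → Set
Word n k = Vec (Fin k) n

-- Membership in Aⁿₘ(k).
Spread : (m : ℕ) {n k : ℕ} → Pred (Word n k) 0ℓ
Spread m = Linked (λ a b → m ≤ ∣ toℕ a - toℕ b ∣)

-- The arcs of B(n,k), including loops.
DeBruijnArc : (n k : ℕ) → Rel (Word n k) 0ℓ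
DeBruijnArc n k x y = ∀ (i j : Fin n) → toℕ j ≡ suc (toℕ i) → lookup x j ≡ lookup y i

S : (n k : ℕ) → SimpleGraph
S n k = simplify (≡-dec _≟ᶠ_) (DeBruijnArc n k)

Sₘ : (m n k : ℕ) → SimpleGraph
Sₘ m n k = induced (S n k) (Spread m)

{-# OPTIONS --safe #-}

-- A 3-coloured graph is represented by a concatenation of words, one for each
-- vertex v, in which every edge x ~ y with colour x < colour y reads xyxy,
-- while v repeats against each non-neighbour of no larger colour.  The map
-- a ↦ ⌊a/m⌋ takes Sₘ(n,k) to words over ⌈k/m⌉ letters with distinct
-- consecutive letters, which have a 3-colouring: on 4 letters, words of
-- length 3 by an explicit rule, and replacing each factor ab by a letter of a
-- smaller alphabet passes from length n + 1 to length n.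
--
-- For k > 3m the letters 0, m, 2m, 3m induce the simplified line digraph of
-- K₄, with vertices ab (a ≠ b) and edges ab – bc.  Orient each edge towards
-- the vertex whose first occurrence in a representing word comes later; then an
-- induced 4-cycle has two edges in each direction.  The 4-cycles of the K₃,₃ of arcs into
-- and out of b force the direction of ab – bc to depend on a alone or on c
-- alone, hence to be that of ab – ba or of bc – cb.  This leaves a tournament
-- on the four letters with a choice for each b, and the six 4-cycles
-- ab, bc, cd, da exclude all 2¹⁰ possibilities.
module Submission where

open import Defs
open import Data.Bool.Base using (Bool; true; false; not; if_then_else_)
import Data.Bool.Properties as Bool
open import Data.Empty using (⊥; ⊥-elim-irr)
open import Data.Fin.Base as Fin using (Fin; zero; suc; toℕ; inject₁; fromℕ<; punchIn)
open import Data.Fin.Patterns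
import Data.Fin.Properties as Fin
open import Data.Irrelevant using () renaming ([_] to irr)
open import Data.List.Base
  using (List; []; _∷_; _++_; [_]; filter; map; concatMap; length; deduplicate; cartesianProductWith; allFin)
open import Data.List.Properties as List
  using (filter-++; filter-≐; filter-none; filter-accept; filter-reject; map-++; ∷-injectiveˡ; ∷-injectiveʳ)
open import Data.List.Membership.DecPropositional using (_∈?_)
open import Data.List.Membership.Propositional using (_∈_)
open import Data.List.Membership.Propositional.Properties
  using (∈-filter⁺; ∈-filter⁻; ∈-concatMap⁺; ∈-deduplicate⁺; ∈-cartesianProductWith⁺; ∈-allFin)
import Data.List.Relation.Unary.All as All
open import Data.List.Relation.Unary.AllPairs using (_∷_)
open import Data.List.Relation.Unary.Any as Any using (here; there)
open import Data.List.Relation.Unary.Linked as ListLinked using ([]; [-]; _∷_) renaming (Linked to Linkedᴸ)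
import Data.List.Relation.Unary.Linked.Properties as ListLinked
open import Data.List.Relation.Unary.Unique.Propositional using (Unique)
import Data.List.Relation.Unary.Unique.Propositional.Properties as Unique
import Data.List.Relation.Unary.Unique.DecPropositional.Properties as DecUnique
open import Data.Nat.Base
  using (ℕ; zero; suc; _+_; _*_; _⊔_; ∣_-_∣; _≤_; _<_; _≥_; z<s; s<s; NonZero)
open import Data.Nat.DivMod using (_/_; _%_; m≡m%n+[m/n]*n; m%n<n; m<n*o⇒m/o<n)
import Data.Nat.Properties as ℕ
open import Data.Nat.Tactic.RingSolver using (solve-∀)
open import Data.Product.Base using (_×_; _,_; proj₁; proj₂; ∃-syntax; Σ-syntax)
open import Data.Product.Properties using (≡-dec)
open import Data.Refinement.Base using (Refinement; value; _,_)
open import Data.Sum.Base as Sum using (_⊎_; inj₁; inj₂; [_,_]′)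
open import Data.Vec.Base as Vec using (Vec; []; _∷_; head; lookup)
open import Data.Vec.Properties as Vec using (lookup-map)
open import Data.Vec.Relation.Unary.Linked as VecLinked using (Linked; []; [-]; _∷_; linked?)
import Data.Vec.Relation.Unary.Linked.Properties as VecLinked
open import Function.Base using (_∘_)
open import Function.Bundles using (Equivalence; mk⇔)
open import Level using (0ℓ)
open import Relation.Binary.Core using (Rel)
open import Relation.Binary.Definitions using (Decidable; DecidableEquality; tri<; tri≈; tri>)
open import Relation.Binary.PropositionalEquality
  using (_≡_; _≢_; refl; sym; trans; cong; cong₂; subst; subst₂; module ≡-Reasoning)
open import Relation.Nullary.Decidable
  using (Dec; yes; no; does; ¬?; _→-dec_; _×-dec_; _⊎-dec_; map′; from-yes; dec-true; dec-false; decidable-stable)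
open import Relation.Nullary.Negation using (¬_; contradiction)
import Relation.Unary as Unary

-- Three-colourable graphs

filter-single : {A : Set} {Q : A → Set} (Q? : Unary.Decidable Q) {z : A} {xs : List A} →
  Unique xs → z ∈ xs → Q z → (∀ {u} → u ∈ xs → Q u → u ≡ z) → filter Q? xs ≡ [ z ]
filter-single Q? (z∉xs ∷ _) (here refl) Qz only =
  trans (filter-accept Q? Qz)
        (cong (_ ∷_) (filter-none Q? (All.tabulate λ u∈xs Qu →
          All.lookup z∉xs u∈xs (sym (only (there u∈xs) Qu)))))
filter-single Q? (x∉xs ∷ uniq) (there z∈xs) Qz only =
  trans (filter-reject Q? λ Qx → All.lookup x∉xs z∈xs (only (here refl) Qx))
        (filter-single Q? uniq z∈xs Qz (only ∘ there))

module _ {A : Set} {R : Rel A 0ℓ} where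

  Linked-++⁻ˡ : ∀ xs {ys} → Linkedᴸ R (xs ++ ys) → Linkedᴸ R xs
  Linked-++⁻ˡ []           _         = []
  Linked-++⁻ˡ (x ∷ [])     _         = [-]
  Linked-++⁻ˡ (x ∷ y ∷ xs) (Rxy ∷ l) = Rxy ∷ Linked-++⁻ˡ (y ∷ xs) l

  Linked-++⁻ʳ : ∀ xs {ys} → Linkedᴸ R (xs ++ ys) → Linkedᴸ R ys
  Linked-++⁻ʳ []       l = l
  Linked-++⁻ʳ (x ∷ xs) l = Linked-++⁻ʳ xs (ListLinked.tail l)

alternating-linked : {A : Set} {x y : A} → x ≢ y → ∀ ℓ → Linkedᴸ _≢_ (alternating x y ℓ)
alternating-linked x≢y 0             = []
alternating-linked x≢y 1             = [-]
alternating-linked x≢y (suc (suc ℓ)) = x≢y ∷ alternating-linked (x≢y ∘ sym) (suc ℓ)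

module _ {A : Set} (_≟_ : DecidableEquality A) where

  restrict-comm : ∀ x y w → restrict _≟_ x y w ≡ restrict _≟_ y x w
  restrict-comm x y = filter-≐ _ _ (Sum.swap , Sum.swap)

  Alternate-sym : ∀ w {x y} → Alternate _≟_ w x y → Alternate _≟_ w y x
  Alternate-sym w {x} {y} (ℓ , alt) =
    ℓ , Sum.swap (Sum.map (trans (restrict-comm y x w)) (trans (restrict-comm y x w)) alt)

  -- Non-alternation is proved through this consequence: having no two equal neighbours passes to
  -- every factor, so one repetition inside one block is enough.
  Alternate⇒linked : ∀ w {x y} → x ≢ y → Alternate _≟_ w x y → Linkedᴸ _≢_ (restrict _≟_ x y w)
  Alternate⇒linked w x≢y (ℓ , inj₁ eq) = subst (Linkedᴸ _≢_) (sym eq) (alternating-linked x≢y ℓ)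
  Alternate⇒linked w x≢y (ℓ , inj₂ eq) = subst (Linkedᴸ _≢_) (sym eq) (alternating-linked (x≢y ∘ sym) ℓ)

-- The status of a vertex relative to v: its colour, and whether it is v, a
-- neighbour of v, or neither.
Status : Set
Status = Fin 3 × Fin 3

pattern self = 0F
pattern near = 1F
pattern far  = 2F

_≟ˢ_ : DecidableEquality Status
_≟ˢ_ = ≡-dec Fin._≟_ Fin._≟_

-- The word contributed by a vertex v of the given colour, each status standing
-- for all vertices having it, in a fixed order.  A vertex of colour 2 cannot
-- precede a non-neighbour of colour 0 throughout a block when they are joined
-- by an increasing path; for those the word reads r r v v.
template : Fin 3 → List Status
template 0F = (0F , self) ∷ (0F , far) ∷ (1F , near) ∷ (1F , far) ∷ (2F , near) ∷ (2F , far)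
            ∷ (0F , far) ∷ (0F , self) ∷ (1F , near) ∷ (1F , far) ∷ (2F , near) ∷ (2F , far) ∷ []
template 1F = (0F , near) ∷ (1F , self) ∷ (0F , far) ∷ (1F , far) ∷ (2F , near) ∷ (2F , far)
            ∷ (0F , near) ∷ (0F , far) ∷ (1F , far) ∷ (1F , self) ∷ (2F , near) ∷ (2F , far) ∷ []
template 2F = (0F , far) ∷ (0F , near) ∷ (1F , near) ∷ (1F , far) ∷ (2F , far)
            ∷ (0F , far) ∷ (2F , self) ∷ (0F , near) ∷ (1F , near) ∷ (2F , self) ∷ (1F , far) ∷ (2F , far) ∷ []

-- Excludes the statuses that no vertex has relative to a v of colour c: only v is `self`, and
-- properness keeps neighbours of v off colour c.
Possible : Fin 3 → Status → Set
Possible c (i , r) = (r ≡ self → i ≡ c) × (i ≡ c → r ≢ near)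

possible? : ∀ c → Unary.Decidable (Possible c)
possible? c (i , r) = ((r Fin.≟ self) →-dec (i Fin.≟ c)) ×-dec ((i Fin.≟ c) →-dec ¬? (r Fin.≟ near))

-- A finite check. The last two hypotheses reflect adjacency of the two vertices: if one is v, the
-- other is a neighbour of v. Each possible status occurs twice in the template, hence the length 4.
template-alternates : ∀ c i r j s → i Fin.< j → Possible c (i , r) → Possible c (j , s) →
  (r ≡ self → s ≡ near) → (s ≡ self → r ≡ near) →
  restrict _≟ˢ_ (i , r) (j , s) (template c) ≡ alternating (i , r) (j , s) 4
template-alternates = from-yes
  (Fin.all? λ c → Fin.all? λ i → Fin.all? λ r → Fin.all? λ j → Fin.all? λ s →
    (i Fin.<? j) →-dec possible? c (i , r) →-dec possible? c (j , s) →-dec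
    ((r Fin.≟ self) →-dec (s Fin.≟ near)) →-dec ((s Fin.≟ self) →-dec (r Fin.≟ near)) →-dec
    List.≡-dec _≟ˢ_ (restrict _≟ˢ_ (i , r) (j , s) (template c)) (alternating (i , r) (j , s) 4))

template-repeats : ∀ c i → i Fin.≤ c →
  ¬ Linkedᴸ _≢_ (restrict _≟ˢ_ (i , far) (c , self) (template c))
template-repeats = from-yes
  (Fin.all? λ c → Fin.all? λ i → (i Fin.≤? c) →-dec
    ¬? (ListLinked.linked? (λ s t → ¬? (s ≟ˢ t)) (restrict _≟ˢ_ (i , far) (c , self) (template c))))

template-self : ∀ c → (c , self) ∈ template c
template-self = from-yes (Fin.all? λ c → _∈?_ _≟ˢ_ (c , self) (template c))

-- The representing word of a 3-coloured graph

module ThreeColourable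
  (G : SimpleGraph)
  (_~?_ : Decidable (SimpleGraph._~_ G))
  (vertices : List (SimpleGraph.Vertex G)) (complete : ∀ v → v ∈ vertices) (unique : Unique vertices)
  (colour : SimpleGraph.Vertex G → Fin 3) (proper : ∀ {x y} → SimpleGraph._~_ G x y → colour x ≢ colour y)
  where

  open SimpleGraph G

  relation : Vertex → Vertex → Fin 3
  relation v u = if does (v ≟ u) then self else if does (v ~? u) then near else far

  status : Vertex → Vertex → Status
  status v u = colour u , relation v u

  relation-self : ∀ v → relation v v ≡ self
  relation-self v with v ≟ v
  ... | yes _  = refl
  ... | no v≢v = contradiction refl v≢v

  relation-near : ∀ {v u} → v ~ u → relation v u ≡ near
  relation-near {v} {u} v~u with v ≟ u | v ~? u
  ... | yes v≡u | _       = contradiction v~u (irrefl v≡u)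
  ... | no _    | yes _   = refl
  ... | no _    | no v≁u  = contradiction v~u v≁u

  relation-far : ∀ {v u} → v ≢ u → ¬ v ~ u → relation v u ≡ far
  relation-far {v} {u} v≢u v≁u with v ≟ u | v ~? u
  ... | yes v≡u | _       = contradiction v≡u v≢u
  ... | no _    | yes v~u = contradiction v~u v≁u
  ... | no _    | no _    = refl

  relation-self⁻ : ∀ {v u} → relation v u ≡ self → v ≡ u
  relation-self⁻ {v} {u} _ with v ≟ u | v ~? u
  relation-self⁻ _  | yes v≡u | _     = v≡u
  relation-self⁻ () | no _    | yes _
  relation-self⁻ () | no _    | no _

  relation-near⁻ : ∀ {v u} → relation v u ≡ near → v ~ u
  relation-near⁻ {v} {u} _ with v ≟ u | v ~? u
  relation-near⁻ () | yes _ | _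
  relation-near⁻ _  | no _  | yes v~u = v~u
  relation-near⁻ () | no _  | no _

  status-possible : ∀ v u → Possible (colour v) (status v u)
  status-possible v u =
    (λ r≡self → cong colour (sym (relation-self⁻ r≡self))) ,
    (λ i≡c r≡near → proper (relation-near⁻ r≡near) (sym i≡c))

  layer : Vertex → Status → List Vertex
  layer v s = filter (λ u → status v u ≟ˢ s) vertices

  block : Vertex → List Vertex
  block v = concatMap (layer v) (template (colour v))

  word : List Vertex
  word = concatMap block vertices

  module _ {v x y : Vertex} (sx≢sy : status v x ≢ status v y) where

    name : Status → Vertex
    name s = if does (s ≟ˢ status v x) then x else y

    restrict-layer-none : ∀ s → s ≢ status v x → s ≢ status v y → restrict _≟_ x y (layer v s) ≡ []
    restrict-layer-none s s≢sx s≢sy = filter-none _ (All.tabulate λ u∈layer →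
      let s≡ = proj₂ (∈-filter⁻ (λ u → status v u ≟ˢ s) {xs = vertices} u∈layer) in
      [ (λ { refl → s≢sx (sym s≡) }) , (λ { refl → s≢sy (sym s≡) }) ]′)

    restrict-layer-one : ∀ {z} → z ≡ x ⊎ z ≡ y → (∀ {u} → u ≡ x ⊎ u ≡ y → status v u ≡ status v z → u ≡ z) →
      restrict _≟_ x y (layer v (status v z)) ≡ [ z ]
    restrict-layer-one {z} z∈ only = filter-single _
      (Unique.filter⁺ (λ u → status v u ≟ˢ status v z) unique)
      (∈-filter⁺ (λ u → status v u ≟ˢ status v z) (complete z) refl) z∈
      λ u∈layer u∈ → only u∈ (proj₂ (∈-filter⁻ (λ u → status v u ≟ˢ status v z) {xs = vertices} u∈layer))

    name-x : name (status v x) ≡ x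
    name-x with status v x ≟ˢ status v x
    ... | yes _     = refl
    ... | no  sx≢sx = contradiction refl sx≢sx

    name-y : name (status v y) ≡ y
    name-y with status v y ≟ˢ status v x
    ... | yes sy≡sx = contradiction (sym sy≡sx) sx≢sy
    ... | no  _     = refl

    -- The statuses of x and y differ and each vertex is enumerated once, so a layer contributes at
    -- most one letter, which `name` recovers from the status.
    restrict-layer : ∀ s →
      restrict _≟_ x y (layer v s) ≡ map name (restrict _≟ˢ_ (status v x) (status v y) [ s ])
    restrict-layer s = step (s ≟ˢ status v x) (s ≟ˢ status v y)
      where
      in-pair? : Unary.Decidable (λ s → s ≡ status v x ⊎ s ≡ status v y)
      in-pair? s = (s ≟ˢ status v x) ⊎-dec (s ≟ˢ status v y)
      step : Dec (s ≡ status v x) → Dec (s ≡ status v y) →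
        restrict _≟_ x y (layer v s) ≡ map name (restrict _≟ˢ_ (status v x) (status v y) [ s ])
      step (yes refl) _ = trans
        (restrict-layer-one (inj₁ refl) λ { (inj₁ eq) _ → eq ; (inj₂ refl) eq → contradiction (sym eq) sx≢sy })
        (sym (trans (cong (map name) (filter-accept in-pair? {xs = []} (inj₁ refl))) (cong [_] name-x)))
      step (no _) (yes refl) = trans
        (restrict-layer-one (inj₂ refl) λ { (inj₁ refl) eq → contradiction eq sx≢sy ; (inj₂ eq) _ → eq })
        (sym (trans (cong (map name) (filter-accept in-pair? {xs = []} (inj₂ refl))) (cong [_] name-y)))
      step (no s≢sx) (no s≢sy) = trans
        (restrict-layer-none s s≢sx s≢sy)
        (sym (cong (map name) (filter-reject in-pair? {xs = []} [ s≢sx , s≢sy ]′)))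

    restrict-layers : ∀ ss →
      restrict _≟_ x y (concatMap (layer v) ss) ≡ map name (restrict _≟ˢ_ (status v x) (status v y) ss)
    restrict-layers []       = refl
    restrict-layers (s ∷ ss) = begin
      restrict _≟_ x y (layer v s ++ concatMap (layer v) ss)
        ≡⟨ filter-++ _ (layer v s) _ ⟩
      restrict _≟_ x y (layer v s) ++ restrict _≟_ x y (concatMap (layer v) ss)
        ≡⟨ cong₂ _++_ (restrict-layer s) (restrict-layers ss) ⟩
      map name (restrictˢ [ s ]) ++ map name (restrictˢ ss)
        ≡⟨ map-++ name (restrictˢ [ s ]) _ ⟨
      map name (restrictˢ [ s ] ++ restrictˢ ss)
        ≡⟨ cong (map name) (filter-++ (λ s → (s ≟ˢ status v x) ⊎-dec (s ≟ˢ status v y)) [ s ] ss) ⟨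
      map name (restrictˢ (s ∷ ss)) ∎
      where
      open ≡-Reasoning
      restrictˢ = restrict _≟ˢ_ (status v x) (status v y)

    block-linked⁻ : Linkedᴸ _≢_ (restrict _≟_ x y (block v)) →
      Linkedᴸ _≢_ (restrict _≟ˢ_ (status v x) (status v y) (template (colour v)))
    block-linked⁻ l = ListLinked.map (λ fs≢ft s≡t → fs≢ft (cong name s≡t))
      (ListLinked.map⁻ (subst (Linkedᴸ _≢_) (restrict-layers (template (colour v))) l))

  block-alternates : ∀ v {x y} → x ~ y → colour x Fin.< colour y →
    restrict _≟_ x y (block v) ≡ alternating x y 4
  block-alternates v {x} {y} x~y cx<cy = begin
    restrict _≟_ x y (block v)
      ≡⟨ restrict-layers sx≢sy (template (colour v)) ⟩
    map (name sx≢sy) (restrict _≟ˢ_ (status v x) (status v y) (template (colour v)))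
      ≡⟨ cong (map (name sx≢sy)) (template-alternates (colour v) _ _ _ _ cx<cy
           (status-possible v x) (status-possible v y) near-y near-x) ⟩
    map (name sx≢sy) (alternating (status v x) (status v y) 4)
      ≡⟨ cong₂ (λ a b → a ∷ b ∷ a ∷ b ∷ []) (name-x sx≢sy) (name-y sx≢sy) ⟩
    alternating x y 4 ∎
    where
    open ≡-Reasoning
    sx≢sy : status v x ≢ status v y
    sx≢sy eq = Fin.<⇒≢ cx<cy (cong proj₁ eq)
    near-y : relation v x ≡ self → relation v y ≡ near
    near-y eq = relation-near (subst (_~ y) (sym (relation-self⁻ eq)) x~y)
    near-x : relation v y ≡ self → relation v x ≡ near
    near-x eq = relation-near (subst (_~ x) (sym (relation-self⁻ eq)) (symm x~y))

  word-alternates : ∀ {x y} → x ~ y → colour x Fin.< colour y →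
    ∀ vs → restrict _≟_ x y (concatMap block vs) ≡ alternating x y (length vs * 4)
  word-alternates x~y cx<cy []       = refl
  word-alternates {x} {y} x~y cx<cy (v ∷ vs) =
    trans (filter-++ _ (block v) _)
          (cong₂ _++_ (block-alternates v x~y cx<cy) (word-alternates x~y cx<cy vs))

  edge⇒alternate : ∀ {x y} → x ~ y → Alternate _≟_ word x y
  edge⇒alternate {x} {y} x~y with Fin.<-cmp (colour x) (colour y)
  ... | tri< cx<cy _ _ = _ , inj₁ (word-alternates x~y cx<cy vertices)
  ... | tri≈ _ cx≡cy _ = contradiction cx≡cy (proper x~y)
  ... | tri> _ _ cy<cx =
    Alternate-sym _≟_ word (_ , inj₁ (word-alternates (symm x~y) cy<cx vertices))

  block-factor : ∀ {R : Rel Vertex 0ℓ} {x y v} → v ∈ vertices →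
    Linkedᴸ R (restrict _≟_ x y word) → Linkedᴸ R (restrict _≟_ x y (block v))
  block-factor {R} {x} {y} = go vertices
    where
    go : ∀ vs {v} → v ∈ vs →
      Linkedᴸ R (restrict _≟_ x y (concatMap block vs)) → Linkedᴸ R (restrict _≟_ x y (block v))
    go (v ∷ vs) (here refl) l =
      Linked-++⁻ˡ _ (subst (Linkedᴸ R) (filter-++ _ (block v) _) l)
    go (u ∷ vs) (there v∈vs) l =
      go vs v∈vs (Linked-++⁻ʳ (restrict _≟_ x y (block u)) (subst (Linkedᴸ R) (filter-++ _ (block u) _) l))

  -- In the block of y, the vertex of no smaller colour, x is `far` and y is `self`; the template
  -- repeats one of them, and the repetition survives in the whole word.
  non-edge⇒¬alternate : ∀ {x y} → x ≢ y → ¬ x ~ y → colour x Fin.≤ colour y → ¬ Alternate _≟_ word x y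
  non-edge⇒¬alternate {x} {y} x≢y x≁y cx≤cy alt = template-repeats (colour y) (colour x) cx≤cy
    (subst₂ (λ r s → Linkedᴸ _≢_ (restrict _≟ˢ_ (colour x , r) (colour y , s) (template (colour y))))
      rx≡far (relation-self y)
      (block-linked⁻ sx≢sy (block-factor (complete y) (Alternate⇒linked _≟_ word x≢y alt))))
    where
    rx≡far : relation y x ≡ far
    rx≡far = relation-far (x≢y ∘ sym) (x≁y ∘ symm)
    sx≢sy : status y x ≢ status y y
    sx≢sy eq = x≢y (sym (relation-self⁻ (trans (cong proj₂ eq) (relation-self y))))

  alternate⇒edge : ∀ {x y} → x ≢ y → Alternate _≟_ word x y → x ~ y
  alternate⇒edge {x} {y} x≢y alt = decidable-stable (x ~? y) λ x≁y →
    [ (λ cx≤cy → non-edge⇒¬alternate x≢y x≁y cx≤cy alt)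
    , (λ cy≤cx → non-edge⇒¬alternate (x≢y ∘ sym) (x≁y ∘ symm) cy≤cx (Alternate-sym _≟_ word alt))
    ]′ (Fin.≤-total (colour x) (colour y))

  ∈-word : ∀ x → x ∈ word
  ∈-word x = ∈-concatMap⁺ block (Any.map x∈block (complete x))
    where
    x∈block : ∀ {v} → x ≡ v → x ∈ block v
    x∈block refl = ∈-concatMap⁺ (layer x) (Any.map (λ { refl → x∈layer }) (template-self (colour x)))
      where
      x∈layer : x ∈ layer x (colour x , self)
      x∈layer = ∈-filter⁺ (λ u → status x u ≟ˢ (colour x , self)) (complete x) (cong (colour x ,_) (relation-self x))

  representable : WordRepresentable G
  representable = word , ∈-word , λ x y x≢y → mk⇔ (alternate⇒edge x≢y) edge⇒alternate

three-colourable⇒word-representable :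
  (G : SimpleGraph) → let open SimpleGraph G in Decidable _~_ →
  (vertices : List Vertex) → (∀ v → v ∈ vertices) →
  (colour : Vertex → Fin 3) → (∀ {x y} → x ~ y → colour x ≢ colour y) →
  WordRepresentable G
three-colourable⇒word-representable G _~?_ vertices complete = ThreeColourable.representable G _~?_
  (deduplicate _≟_ vertices) (∈-deduplicate⁺ _≟_ ∘ complete) (DecUnique.deduplicate-! _≟_ vertices)
  where open SimpleGraph G

-- Colourings of words with distinct consecutive letters

-- Loops may be included among the arcs: for n ≥ 2 they sit at constant words, whose consecutive
-- letters are equal.
Colourable : ℕ → ℕ → Set
Colourable n N = Σ[ f ∈ (Word n N → Fin 3) ]
  (∀ x y → Linked _≢_ x → Linked _≢_ y → DeBruijnArc n N x y → f x ≢ f y)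

colourable₂ : Colourable 2 3
colourable₂ = head , λ where
  (a ∷ b ∷ []) (c ∷ d ∷ []) (a≢b ∷ _) _ arc a≡c → a≢b (trans a≡c (sym (arc 0F 1F refl)))

-- A colour different from both arguments.
third : Fin 4 → Fin 4 → Fin 3
third 0F 1F = 2F
third 0F _  = 1F
third 1F 0F = 2F
third 1F _  = 0F
third 2F 0F = 1F
third 2F _  = 0F
third 3F 0F = 1F
third 3F _  = 0F

-- The neighbours of a3c have middle letter a or c.
middle : Word 3 4 → Fin 3
middle (a ∷ 0F ∷ c ∷ []) = 0F
middle (a ∷ 1F ∷ c ∷ []) = 1F
middle (a ∷ 2F ∷ c ∷ []) = 2F
middle (a ∷ 3F ∷ c ∷ []) = third a c

middle-proper : ∀ a b c d → a ≢ b → b ≢ c → c ≢ d → middle (a ∷ b ∷ c ∷ []) ≢ middle (b ∷ c ∷ d ∷ [])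
middle-proper = from-yes
  (Fin.all? λ a → Fin.all? λ b → Fin.all? λ c → Fin.all? λ d →
    ¬? (a Fin.≟ b) →-dec ¬? (b Fin.≟ c) →-dec ¬? (c Fin.≟ d) →-dec
    ¬? (middle (a ∷ b ∷ c ∷ []) Fin.≟ middle (b ∷ c ∷ d ∷ [])))

colourable₃ : Colourable 3 4
colourable₃ = middle , proper
  where
  proper : ∀ x y → Linked _≢_ x → Linked _≢_ y → DeBruijnArc 3 4 x y → middle x ≢ middle y
  proper (a ∷ b ∷ c ∷ []) (b′ ∷ c′ ∷ d ∷ []) (a≢b ∷ b≢c ∷ _) (_ ∷ c′≢d ∷ _) arc
    with refl ← arc 0F 1F refl | refl ← arc 1F 2F refl = middle-proper a b c d a≢b b≢c c′≢d

-- The case z = b never occurs in a word, but makes the property pass to extend c.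
Separating : ∀ {M N} → (Fin M → Fin M → Fin N) → Set
Separating c = ∀ a b z → a ≢ b → c a b ≢ c b z

separating? : ∀ {M N} → Unary.Decidable (Separating {M} {N})
separating? c = Fin.all? λ a → Fin.all? λ b → Fin.all? λ z →
  ¬? (a Fin.≟ b) →-dec ¬? (c a b Fin.≟ c b z)

module _ {M N : ℕ} (c : Fin M → Fin M → Fin N) where

  pairs : ∀ {n} → Vec (Fin M) (suc n) → Vec (Fin N) n
  pairs (a ∷ [])     = []
  pairs (a ∷ b ∷ xs) = c a b ∷ pairs (b ∷ xs)

  lookup-pairs : ∀ {n} (xs : Vec (Fin M) (suc n)) i →
    lookup (pairs xs) i ≡ c (lookup xs (inject₁ i)) (lookup xs (suc i))
  lookup-pairs (a ∷ b ∷ xs) zero    = refl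
  lookup-pairs (a ∷ b ∷ xs) (suc i) = lookup-pairs (b ∷ xs) i

  pairs-linked : Separating c → ∀ {n} {xs : Vec (Fin M) (suc n)} → Linked _≢_ xs → Linked _≢_ (pairs xs)
  pairs-linked sep {xs = a ∷ []}         _                 = []
  pairs-linked sep {xs = a ∷ b ∷ []}     _                 = [-]
  pairs-linked sep {xs = a ∷ b ∷ z ∷ xs} (a≢b ∷ l) = sep a b z a≢b ∷ pairs-linked sep l

  pairs-arc : ∀ {n} (x y : Word (suc n) M) → DeBruijnArc (suc n) M x y → DeBruijnArc n N (pairs x) (pairs y)
  pairs-arc x y arc i j j≡1+i = begin
    lookup (pairs x) j
      ≡⟨ lookup-pairs x j ⟩
    c (lookup x (inject₁ j)) (lookup x (suc j))
      ≡⟨ cong₂ c (arc (inject₁ i) (inject₁ j) inject₁j≡1+inject₁i) (arc (suc i) (suc j) (cong suc j≡1+i)) ⟩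
    c (lookup y (inject₁ i)) (lookup y (suc i))
      ≡⟨ lookup-pairs y i ⟨
    lookup (pairs y) i ∎
    where
    open ≡-Reasoning
    inject₁j≡1+inject₁i : toℕ (inject₁ j) ≡ suc (toℕ (inject₁ i))
    inject₁j≡1+inject₁i = trans (Fin.toℕ-inject₁ j) (trans j≡1+i (cong suc (sym (Fin.toℕ-inject₁ i))))

  -- `pairs` sends arcs to arcs and keeps consecutive letters distinct, so colourings pull back
  -- along it.
  colourable-suc : Separating c → ∀ {n} → Colourable n N → Colourable (suc n) M
  colourable-suc sep (f , proper) = f ∘ pairs , λ x y lx ly arc →
    proper (pairs x) (pairs y) (pairs-linked sep lx) (pairs-linked sep ly) (pairs-arc x y arc)

-- Letter a stands for the set {u , v} at position a of the table; the sets
-- form an antichain, and a member of the a-th set outside the b-th is chosen.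
select : ∀ {M N} → Vec (Fin N × Fin N) M → Fin M → Fin M → Fin N
select table a b = if does ((u Fin.≟ u′) ⊎-dec (u Fin.≟ v′)) then v else u
  where
  u = proj₁ (lookup table a)
  v = proj₂ (lookup table a)
  u′ = proj₁ (lookup table b)
  v′ = proj₂ (lookup table b)

select₄ : Fin 6 → Fin 6 → Fin 4
select₄ = select ((0F , 1F) ∷ (0F , 2F) ∷ (0F , 3F) ∷ (1F , 2F) ∷ (1F , 3F) ∷ (2F , 3F) ∷ [])

select₆ : Fin 10 → Fin 10 → Fin 6
select₆ = select ((0F , 1F) ∷ (0F , 2F) ∷ (0F , 3F) ∷ (0F , 4F) ∷ (1F , 2F) ∷
                  (1F , 3F) ∷ (1F , 4F) ∷ (2F , 3F) ∷ (2F , 4F) ∷ (3F , 4F) ∷ [])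

-- The letter chosen for a, b lies outside the set of b, while the one chosen for b, z lies inside
-- it for every z.
separating₄ : Separating select₄
separating₄ = from-yes (separating? select₄)

separating₆ : Separating select₆
separating₆ = from-yes (separating? select₆)

extend : ∀ {M N} → (Fin M → Fin M → Fin N) → Fin (suc M) → Fin (suc M) → Fin (suc N)
extend c zero    _       = zero
-- The second argument a is a placeholder; comparing with this value uses the case z = b of
-- `Separating`.
extend c (suc a) zero    = suc (c a a)
extend c (suc a) (suc b) = suc (c a b)

-- The value 0 marks the factors that begin with the new letter; of two successive factors at most
-- one does, because a ≢ b.
extend-separating : ∀ {M N} {c : Fin M → Fin M → Fin N} → Separating c → Separating (extend c)
extend-separating sep zero    zero    _       a≢b _  = a≢b refl
extend-separating sep zero    (suc b) zero    _   ()
extend-separating sep zero    (suc b) (suc z) _   ()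
extend-separating sep (suc a) zero    _       _   ()
extend-separating sep (suc a) (suc b) zero    a≢b eq = sep a b b (a≢b ∘ cong suc) (Fin.suc-injective eq)
extend-separating sep (suc a) (suc b) (suc z) a≢b eq = sep a b z (a≢b ∘ cong suc) (Fin.suc-injective eq)

-- Each further unit of length thus gains two letters, which keeps the alphabet at twice the length.
separating-+2 : ∀ N → Σ[ c ∈ (Fin (6 + N) → Fin (6 + N) → Fin (4 + N)) ] Separating c
separating-+2 zero    = select₄ , separating₄
separating-+2 (suc N) with c , sep ← separating-+2 N = extend c , extend-separating sep

colourable₄ : Colourable 4 6
colourable₄ = colourable-suc select₄ separating₄ colourable₃

colourable₅₊ : ∀ n → Colourable (5 + n) (10 + n * 2)
colourable₅₊ zero    = colourable-suc select₆ separating₆ colourable₄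
-- Here the map goes from 12 + 2n letters to 10 + 2n.
colourable₅₊ (suc n) with c , sep ← separating-+2 (6 + n * 2) = colourable-suc c sep (colourable₅₊ n)

-- Division of letters by m

module _ (m : ℕ) .{{_ : NonZero m}} where

  -- With equal quotients the distance is that of two remainders, which is below m.
  /-separates : ∀ a b → m ≤ ∣ a - b ∣ → a / m ≢ b / m
  /-separates a b m≤∣a-b∣ a/m≡b/m = ℕ.<-irrefl refl (begin-strict
    m
      ≤⟨ m≤∣a-b∣ ⟩
    ∣ a - b ∣
      ≡⟨ cong₂ ∣_-_∣ (expand a) (trans (expand b) (cong (λ q → q * m + b % m) (sym a/m≡b/m))) ⟩
    ∣ a / m * m + a % m - a / m * m + b % m ∣
      ≡⟨ ℕ.∣m+n-m+o∣≡∣n-o∣ (a / m * m) (a % m) (b % m) ⟩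
    ∣ a % m - b % m ∣
      ≤⟨ ℕ.∣m-n∣≤m⊔n (a % m) (b % m) ⟩
    a % m ⊔ b % m
      <⟨ ℕ.⊔-pres-<m (m%n<n a m) (m%n<n b m) ⟩
    m ∎)
    where
    open ℕ.≤-Reasoning
    expand : ∀ a → a ≡ a / m * m + a % m
    expand a = trans (m≡m%n+[m/n]*n a m) (ℕ.+-comm (a % m) (a / m * m))

  module _ {k N : ℕ} (k≤N*m : k ≤ N * m) where

    quotient : Fin k → Fin N
    quotient a = fromℕ< (m<n*o⇒m/o<n (ℕ.<-≤-trans (Fin.toℕ<n a) k≤N*m))

    toℕ-quotient : ∀ a → toℕ (quotient a) ≡ toℕ a / m
    toℕ-quotient a = Fin.toℕ-fromℕ< _

    quotients-linked : ∀ {n} {x : Word n k} → Spread m x → Linked _≢_ (Vec.map quotient x)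
    quotients-linked = VecLinked.map⁺ ∘ VecLinked.map λ {a} {b} m≤∣a-b∣ eq →
      /-separates (toℕ a) (toℕ b) m≤∣a-b∣
        (trans (sym (toℕ-quotient a)) (trans (cong toℕ eq) (toℕ-quotient b)))

words : ∀ n k → List (Word n k)
words zero    k = [ [] ]
words (suc n) k = cartesianProductWith _∷_ (allFin k) (words n k)

∈-words : ∀ {n k} (x : Word n k) → x ∈ words n k
∈-words []      = here refl
∈-words (a ∷ x) = ∈-cartesianProductWith⁺ _∷_ (∈-allFin a) (∈-words x)

module _ {A : Set} {P : A → Set} (P? : Unary.Decidable P) where

  refinements : A → List (Refinement A P)
  refinements x with P? x
  ... | yes p = [ x , irr p ]
  ... | no  _ = []

  ∈-refinements : ∀ (x : Refinement A P) → x ∈ refinements (value x)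
  ∈-refinements (x , irr p) with P? x
  ... | yes _ = here refl
  ... | no ¬p = ⊥-elim-irr (¬p p)

arc? : ∀ n k → Decidable (DeBruijnArc n k)
arc? n k x y = Fin.all? λ i → Fin.all? λ j →
  (toℕ j ℕ.≟ suc (toℕ i)) →-dec (lookup x j Fin.≟ lookup y i)

map-arc : ∀ {n k N} (h : Fin k → Fin N) (x y : Word n k) →
  DeBruijnArc n k x y → DeBruijnArc n N (Vec.map h x) (Vec.map h y)
map-arc h x y arc i j j≡1+i =
  trans (lookup-map j h x) (trans (cong h (arc i j j≡1+i)) (sym (lookup-map i h y)))

-- Letterwise division by m preserves arcs and makes consecutive letters distinct, so the colouring
-- of words over N letters pulls back.
colourable⇒word-representable : ∀ m {n k N} → .{{_ : NonZero m}} →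
  k ≤ N * m → Colourable n N → WordRepresentable (Sₘ m n k)
colourable⇒word-representable m {n} {k} k≤N*m (f , proper) =
  three-colourable⇒word-representable (Sₘ m n k)
    (λ (x , _) (y , _) → ¬? (Vec.≡-dec Fin._≟_ x y) ×-dec (arc? n k x y ⊎-dec arc? n k y x))
    (concatMap (refinements spread?) (words n k))
    (λ v → ∈-concatMap⁺ (refinements spread?) (Any.map (λ { refl → ∈-refinements spread? v }) (∈-words (value v))))
    (λ (x , _) → f (Vec.map h x))
    λ { {x , irr lx} {y , irr ly} (_ , arcs) eq → ⊥-elim-irr
      ([ (λ arc → proper _ _ (linked lx) (linked ly) (map-arc h x y arc) eq)
       , (λ arc → proper _ _ (linked ly) (linked lx) (map-arc h y x arc) (sym eq)) ]′ arcs) }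
  where
  h = quotient m k≤N*m
  linked = quotients-linked m k≤N*m
  spread? : Unary.Decidable (Spread m)
  spread? = linked? λ a b → m ℕ.≤? ∣ toℕ a - toℕ b ∣

-- Four-cycles in word-representable graphs

module _ {A : Set} where

  -- Alternation starting with x: `take` consumes x and swaps the roles, so y must come next.
  data Alternating (x y : A) : List A → Set where
    []   : Alternating x y []
    skip : ∀ {z w} → z ≢ x → z ≢ y → Alternating x y w → Alternating x y (z ∷ w)
    take : ∀ {w} → Alternating y x w → Alternating x y (x ∷ w)

  -- The hypotheses say that the word, restricted to x, y, z, u, is a prefix
  -- of xyzuxyzu…; consuming its first letter rotates the four roles.
  semi-transitive : ∀ {x y z u w} → x ≢ y → y ≢ z → z ≢ u → u ≢ x → x ≢ z → y ≢ u →
    Alternating x y w → Alternating y z w → Alternating z u w → Alternating x u w →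
    Alternating x z w × Alternating y u w
  semi-transitive _ _ _ _ _ _ [] [] [] [] = [] , []
  semi-transitive x≢y y≢z z≢u u≢x x≢z y≢u (take xy) yz zu xu with yz | zu | xu
  ... | take _         | _             | _            = contradiction refl x≢y
  ... | skip _ _ _     | take _        | _            = contradiction refl x≢z
  ... | skip _ _ _     | skip _ _ _    | skip x≢x _ _ = contradiction refl x≢x
  ... | skip x≢y _ yz  | skip _ x≢u zu | take ux
    with yu , zx ← semi-transitive y≢z z≢u u≢x x≢y y≢u (x≢z ∘ sym) yz zu ux xy
    = take zx , skip x≢y x≢u yu
  semi-transitive x≢y y≢z z≢u u≢x x≢z y≢u (skip h≢x h≢y xy) yz zu xu with yz | zu | xu
  ... | take _         | _             | _            = contradiction refl h≢y
  ... | skip _ h≢z _   | take _        | _            = contradiction refl h≢z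
  ... | skip _ _ _     | skip _ _ _    | take _       = contradiction refl h≢x
  ... | skip _ h≢z yz  | skip _ h≢u zu | skip _ _ xu
    with xz , yu ← semi-transitive x≢y y≢z z≢u u≢x x≢z y≢u xy yz zu xu
    = skip h≢x h≢z xz , skip h≢y h≢u yu

module _ {A : Set} (_≟_ : DecidableEquality A) where

  alternating⁺ : ∀ {x y} → x ≢ y → ∀ w ℓ → restrict _≟_ x y w ≡ alternating x y ℓ → Alternating x y w
  alternating⁺ x≢y []      ℓ eq = []
  alternating⁺ {x} {y} x≢y (z ∷ w) ℓ eq with z ≟ x | z ≟ y
  alternating⁺ {x} {y} x≢y (z ∷ w) (suc ℓ) eq | yes refl | _ =
    take (alternating⁺ (x≢y ∘ sym) w ℓ (trans (restrict-comm _≟_ y x w) (∷-injectiveʳ eq)))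
  alternating⁺ x≢y (z ∷ w) (suc ℓ) eq | no _ | yes refl = contradiction (sym (∷-injectiveˡ eq)) x≢y
  alternating⁺ x≢y (z ∷ w) ℓ eq | no z≢x | no z≢y = skip z≢x z≢y (alternating⁺ x≢y w ℓ eq)

  alternating⁻ : ∀ {x y w} → Alternating x y w → ∃[ ℓ ] restrict _≟_ x y w ≡ alternating x y ℓ
  alternating⁻ [] = 0 , refl
  alternating⁻ {x} {y} (skip z≢x z≢y alt) with ℓ , eq ← alternating⁻ alt =
    ℓ , trans (filter-reject (λ z → (z ≟ x) ⊎-dec (z ≟ y)) [ z≢x , z≢y ]′) eq
  alternating⁻ {x} {y} (take {w} alt) with ℓ , eq ← alternating⁻ alt =
    suc ℓ , trans (filter-accept (λ z → (z ≟ x) ⊎-dec (z ≟ y)) (inj₁ refl))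
                  (cong (x ∷_) (trans (restrict-comm _≟_ x y w) eq))

  position : A → List A → ℕ
  position x []      = 0
  position x (z ∷ w) = if does (x ≟ z) then 0 else suc (position x w)

  position-here : ∀ x w → position x (x ∷ w) ≡ 0
  position-here x w with x ≟ x
  ... | yes _  = refl
  ... | no x≢x = contradiction refl x≢x

  position-there : ∀ {x z} w → z ≢ x → position x (z ∷ w) ≡ suc (position x w)
  position-there {x} {z} w z≢x with x ≟ z
  ... | yes x≡z = contradiction (sym x≡z) z≢x
  ... | no _    = refl

  alternating-position : ∀ {x y w} → x ≢ y → y ∈ w → Alternating x y w → position x w < position y w
  alternating-position {x} {y} x≢y _ (take {w} _) =
    subst₂ _<_ (sym (position-here x w)) (sym (position-there w x≢y)) z<s
  alternating-position x≢y (here refl) (skip _ y≢y _) = contradiction refl y≢y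
  alternating-position x≢y (there y∈w) (skip {w = w} z≢x z≢y alt) =
    subst₂ _<_ (sym (position-there w z≢x)) (sym (position-there w z≢y))
      (s<s (alternating-position x≢y y∈w alt))

-- Balance of induced four-cycles

bit : Bool → ℕ
bit b = if b then 1 else 0

Balanced : Bool → Bool → Bool → Bool → Set
Balanced p q r s = bit p + bit q + bit r + bit s ≡ 2

module Represented (G : SimpleGraph) (representation : WordRepresentable G) where

  open SimpleGraph G

  w : List Vertex
  w = proj₁ representation

  occurs : ∀ x → x ∈ w
  occurs = proj₁ (proj₂ representation)

  before : Vertex → Vertex → Bool
  before x y = does (position _≟_ x w ℕ.<? position _≟_ y w)

  ~⇒≢ : ∀ {x y} → x ~ y → x ≢ y
  ~⇒≢ x~y x≡y = irrefl x≡y x~y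

  orientation : ∀ {x y} → x ~ y →
    (Alternating x y w × position _≟_ x w < position _≟_ y w) ⊎
    (Alternating y x w × position _≟_ y w < position _≟_ x w)
  orientation {x} {y} x~y with Equivalence.from (proj₂ (proj₂ representation) x y (~⇒≢ x~y)) x~y
  ... | ℓ , inj₁ eq = inj₁ (alt , alternating-position _≟_ (~⇒≢ x~y) (occurs y) alt)
    where alt = alternating⁺ _≟_ (~⇒≢ x~y) w ℓ eq
  ... | ℓ , inj₂ eq = inj₂ (alt , alternating-position _≟_ (~⇒≢ (symm x~y)) (occurs x) alt)
    where alt = alternating⁺ _≟_ (~⇒≢ (symm x~y)) w ℓ (trans (restrict-comm _≟_ y x w) eq)

  <⇒alternating : ∀ {x y} → x ~ y → position _≟_ x w < position _≟_ y w → Alternating x y w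
  <⇒alternating x~y px<py with orientation x~y
  ... | inj₁ (alt , _)   = alt
  ... | inj₂ (_ , py<px) = contradiction px<py (ℕ.<-asym py<px)

  before-antisym : ∀ {x y} → x ~ y → before y x ≡ not (before x y)
  before-antisym {x} {y} x~y with orientation x~y
  ... | inj₁ (_ , px<py) = trans (dec-false (_ ℕ.<? _) (ℕ.<-asym px<py)) (cong not (sym (dec-true (_ ℕ.<? _) px<py)))
  ... | inj₂ (_ , py<px) = trans (dec-true (_ ℕ.<? _) py<px) (cong not (sym (dec-false (_ ℕ.<? _) (ℕ.<-asym py<px))))

  before⇒< : ∀ {x y} → before x y ≡ true → position _≟_ x w < position _≟_ y w
  before⇒< eq = ℕ.<ᵇ⇒< _ _ (Equivalence.from Bool.T-≡ eq)

  record Cycle (x y z u : Vertex) : Set where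
    constructor cycle
    field
      x~y : x ~ y
      y~z : y ~ z
      z~u : z ~ u
      u~x : u ~ x
      x≢z : x ≢ z
      y≢u : y ≢ u
      x≁z : ¬ x ~ z
      y≁u : ¬ y ~ u

  rotate : ∀ {x y z u} → Cycle x y z u → Cycle y z u x
  rotate (cycle x~y y~z z~u u~x x≢z y≢u x≁z y≁u) =
    cycle y~z z~u u~x x~y y≢u (x≢z ∘ sym) y≁u (x≁z ∘ symm)

  reverse : ∀ {x y z u} → Cycle x y z u → Cycle u z y x
  reverse (cycle x~y y~z z~u u~x x≢z y≢u x≁z y≁u) =
    cycle (symm z~u) (symm y~z) (symm x~y) (symm u~x) (y≢u ∘ sym) (x≢z ∘ sym) (y≁u ∘ symm) (x≁z ∘ symm)

  -- Three rises put x before u as well, so `semi-transitive` applies to the four edges and makes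
  -- the non-adjacent x and z alternate.
  no-rising : ∀ {x y z u} → Cycle x y z u → before x y ≡ true → before y z ≡ true → before z u ≡ true → ⊥
  no-rising {x} {z = z} (cycle x~y y~z z~u u~x x≢z y≢u x≁z _) xy yz zu =
    x≁z (Equivalence.to (proj₂ (proj₂ representation) x z x≢z) (_ , inj₁ (proj₂ (alternating⁻ _≟_ xz))))
    where
    xz = proj₁ (semi-transitive (~⇒≢ x~y) (~⇒≢ y~z) (~⇒≢ z~u) (~⇒≢ u~x) x≢z y≢u
      (<⇒alternating x~y (before⇒< xy)) (<⇒alternating y~z (before⇒< yz)) (<⇒alternating z~u (before⇒< zu))
      (<⇒alternating (symm u~x) (ℕ.<-trans (before⇒< xy) (ℕ.<-trans (before⇒< yz) (before⇒< zu)))))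

  no-falling : ∀ {x y z u} → Cycle x y z u → before x y ≡ false → before y z ≡ false → before z u ≡ false → ⊥
  no-falling c@(cycle x~y y~z z~u _ _ _ _ _) xy yz zu =
    no-rising (reverse c) (flip z~u zu) (flip y~z yz) (flip x~y xy)
    where
    flip : ∀ {x y} → x ~ y → before x y ≡ false → before y x ≡ true
    flip x~y eq = trans (before-antisym x~y) (cong not eq)

  -- An unbalanced pattern has three equal directions, consecutive up to rotation.
  cycle-balanced : ∀ {x y z u} → Cycle x y z u → Balanced (before x y) (before y z) (before z u) (before u x)
  cycle-balanced {x} {y} {z} {u} c = go _ _ _ _ refl refl refl refl
    where
    go : ∀ p q r s → before x y ≡ p → before y z ≡ q → before z u ≡ r → before u x ≡ s → Balanced p q r s
    go true  true  true  _     xy yz zu ux = contradiction zu (no-rising c xy yz)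
    go false true  true  true  xy yz zu ux = contradiction ux (no-rising (rotate c) yz zu)
    go true  false true  true  xy yz zu ux = contradiction xy (no-rising (rotate (rotate c)) zu ux)
    go true  true  false true  xy yz zu ux = contradiction yz (no-rising (rotate (rotate (rotate c))) ux xy)
    go false false false _     xy yz zu ux = contradiction zu (no-falling c xy yz)
    go true  false false false xy yz zu ux = contradiction ux (no-falling (rotate c) yz zu)
    go false true  false false xy yz zu ux = contradiction xy (no-falling (rotate (rotate c)) zu ux)
    go false false true  false xy yz zu ux = contradiction yz (no-falling (rotate (rotate (rotate c))) ux xy)
    go true  true  false false _ _ _ _ = refl
    go true  false true  false _ _ _ _ = refl
    go true  false false true  _ _ _ _ = refl
    go false true  true  false _ _ _ _ = refl
    go false true  false true  _ _ _ _ = refl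
    go false false true  true  _ _ _ _ = refl

-- Balance of a 2 × 2 minor p s / q r of a 0-1 matrix reads p + r = q + s, so
-- a minor with a non-constant row has constant columns.
balanced-minor : ∀ p q r s → Balanced p (not q) r (not s) → p ≢ s → q ≡ p
balanced-minor true  true  _     _     _ _   = refl
balanced-minor false false _     _     _ _   = refl
balanced-minor true  _     _     true  _ p≢s = contradiction refl p≢s
balanced-minor false _     _     false _ p≢s = contradiction refl p≢s
balanced-minor true  false true  false () _
balanced-minor true  false false false () _
balanced-minor false true  true  true  () _
balanced-minor false true  false true  () _

-- If row i is not constant, each of its entries differs from another entry of that row; the minors
-- through these two columns make every row agree with row i. Diagonal entries serve as
-- representatives since they will be the edges ab - ba.
row-or-column : ∀ {n} (M : Fin n → Fin n → Bool) →
  (∀ {i i′ j j′} → i ≢ i′ → j ≢ j′ → Balanced (M i j) (not (M i′ j)) (M i′ j′) (not (M i j′))) →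
  (∀ i j → M i j ≡ M i i) ⊎ (∀ i j → M i j ≡ M j j)
row-or-column M minors with Fin.any? (λ i → Fin.any? (λ j → ¬? (M i j Bool.≟ M i i)))
... | no  constant = inj₁ λ i j → decidable-stable (M i j Bool.≟ M i i) λ Mij≢Mii → constant (i , j , Mij≢Mii)
... | yes (i , j , Mij≢Mii) = inj₂ λ i′ j′ → trans (column i′ j′) (sym (column j′ j′))
  where
  differs : ∀ j′ → ∃[ k ] M i j′ ≢ M i k
  differs j′ with M i j′ Bool.≟ M i j
  ... | no  Mij′≢Mij = j , Mij′≢Mij
  ... | yes Mij′≡Mij = i , λ Mij′≡Mii → Mij≢Mii (trans (sym Mij′≡Mij) Mij′≡Mii)
  column : ∀ i′ j′ → M i′ j′ ≡ M i j′
  column i′ j′ with i Fin.≟ i′ | differs j′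
  ... | yes refl | _            = refl
  ... | no i≢i′  | k , Mij′≢Mik = balanced-minor _ _ (M i′ k) _ (minors i≢i′ λ { refl → Mij′≢Mik refl }) Mij′≢Mik

all-vectors? : ∀ {n} {P : Vec Bool n → Set} → Unary.Decidable P → Dec (∀ v → P v)
all-vectors? {zero}  P? = map′ (λ { p [] → p }) (λ p → p []) (P? [])
all-vectors? {suc n} P? = map′
  (λ { (pt , pf) (true ∷ v) → pt v ; (pt , pf) (false ∷ v) → pf v })
  (λ p → p ∘ (true ∷_) , p ∘ (false ∷_))
  (all-vectors? (P? ∘ (true ∷_)) ×-dec all-vectors? (P? ∘ (false ∷_)))

-- The line digraph of K₄

-- T a b stands for "ab precedes ba", and orient κ T a b c for "ab precedes bc".
orient : (Fin 4 → Bool) → (Fin 4 → Fin 4 → Bool) → Fin 4 → Fin 4 → Fin 4 → Bool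
orient κ T a b c = if κ b then T a b else T c b

BalancedSquare : (Fin 4 → Bool) → (Fin 4 → Fin 4 → Bool) → Fin 4 → Fin 4 → Fin 4 → Fin 4 → Set
BalancedSquare κ T a b c d = Balanced (orient κ T a b c) (orient κ T b c d) (orient κ T c d a) (orient κ T d a b)

balancedSquare? : ∀ κ T a b c d → Dec (BalancedSquare κ T a b c d)
balancedSquare? κ T a b c d = _ ℕ.≟ 2

tournament : Vec Bool 6 → Fin 4 → Fin 4 → Bool
tournament (t₀₁ ∷ t₀₂ ∷ t₀₃ ∷ t₁₂ ∷ t₁₃ ∷ t₂₃ ∷ []) = λ where
  0F 1F → t₀₁
  0F 2F → t₀₂
  0F 3F → t₀₃
  1F 2F → t₁₂
  1F 3F → t₁₃
  2F 3F → t₂₃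
  1F 0F → not t₀₁
  2F 0F → not t₀₂
  3F 0F → not t₀₃
  2F 1F → not t₁₂
  3F 1F → not t₁₃
  3F 2F → not t₂₃
  -- A default for the diagonal, which squares on distinct letters never reach.
  _  _  → true

-- The cyclic orders of the four letters, written from 0. An order and its reverse give different
-- cycles, on opposite arcs.
Squares : (Fin 4 → Fin 4 → Fin 4 → Fin 4 → Set) → Set
Squares P = P 0F 1F 2F 3F × P 0F 1F 3F 2F × P 0F 2F 1F 3F × P 0F 2F 3F 1F × P 0F 3F 1F 2F × P 0F 3F 2F 1F

unbalanced : ∀ κ t → ¬ Squares (BalancedSquare (lookup κ) (tournament t))
unbalanced = from-yes (all-vectors? λ κ → all-vectors? λ t →
  let bs? = balancedSquare? (lookup κ) (tournament t) in
  ¬? (bs? 0F 1F 2F 3F ×-dec bs? 0F 1F 3F 2F ×-dec bs? 0F 2F 1F 3F ×-dec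
      bs? 0F 2F 3F 1F ×-dec bs? 0F 3F 1F 2F ×-dec bs? 0F 3F 2F 1F))

-- The parameters describe an induced copy of the simplified line digraph of K₄ in G. Irrelevance
-- makes a vertex depend on its two letters alone.
module K₄ (G : SimpleGraph) (representation : WordRepresentable G)
  (arc : (a b : Fin 4) → .(a ≢ b) → SimpleGraph.Vertex G)
  (arc-injective : ∀ {a b c d : Fin 4} .(p : a ≢ b) .(q : c ≢ d) → arc a b p ≡ arc c d q → a ≡ c × b ≡ d)
  (consecutive : ∀ {a b c} (p : a ≢ b) (q : b ≢ c) → SimpleGraph._~_ G (arc a b p) (arc b c q))
  (consecutive⁻ : ∀ {a b c d} .(p : a ≢ b) .(q : c ≢ d) → SimpleGraph._~_ G (arc a b p) (arc c d q) →
    b ≡ c ⊎ d ≡ a)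
  where

  open SimpleGraph G
  open Represented G representation

  precedes : (a b c : Fin 4) → .(a ≢ b) → .(b ≢ c) → Bool
  precedes a b c p q = before (arc a b p) (arc b c q)

  -- Whether ab precedes ba, always read off the case a < b so that T b a
  -- computes to not (T a b), as tournament does.
  T : (a b : Fin 4) → .(a ≢ b) → Bool
  T a b p = if does (a Fin.<? b) then precedes a b a p (p ∘ sym) else not (precedes b a b (p ∘ sym) p)

  T≡precedes : ∀ {a b} (p : a ≢ b) → T a b p ≡ precedes a b a p (p ∘ sym)
  T≡precedes {a} {b} p with does (a Fin.<? b)
  ... | true  = refl
  ... | false = sym (before-antisym (consecutive (p ∘ sym) p))

  module _ (b : Fin 4) where

    other : ∀ i → b ≢ punchIn b i
    other i = Fin.punchInᵢ≢i b i ∘ sym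

    -- Rows are the arcs into b and columns the arcs out of b, indexed by the three other letters.
    M : Fin 3 → Fin 3 → Bool
    M i j = precedes (punchIn b i) b (punchIn b j) (other i ∘ sym) (other j)

    -- A 4-cycle alternates between arcs into and out of b, and the edges traversed from an outgoing
    -- to an incoming arc give the negated entries. Two arcs on the same side are not adjacent,
    -- since b would equal another letter.
    bipartite : ∀ {i i′ j j′} → i ≢ i′ → j ≢ j′ →
      Balanced (M i j) (not (M i′ j)) (M i′ j′) (not (M i j′))
    bipartite {i} {i′} {j} {j′} i≢i′ j≢j′ =
      subst₂ (λ q s → Balanced (M i j) q (M i′ j′) s)
        (before-antisym (edge i′ j)) (before-antisym (edge i j′))
        (cycle-balanced (cycle (edge i j) (symm (edge i′ j)) (edge i′ j′) (symm (edge i j′))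
          (λ eq → i≢i′ (Fin.punchIn-injective b i i′ (proj₁ (arc-injective _ _ eq))))
          (λ eq → j≢j′ (Fin.punchIn-injective b j j′ (proj₂ (arc-injective _ _ eq))))
          ([ other i′ , other i ]′ ∘ consecutive⁻ _ _)
          ([ other j ∘ sym , other j′ ∘ sym ]′ ∘ consecutive⁻ _ _)))
      where
      edge : ∀ i j → arc (punchIn b i) b (other i ∘ sym) ~ arc b (punchIn b j) (other j)
      edge i j = consecutive (other i ∘ sym) (other j)

    reindex : (P : ∀ a c → .(a ≢ b) → .(b ≢ c) → Set) →
      (∀ i j → P (punchIn b i) (punchIn b j) (other i ∘ sym) (other j)) →
      ∀ {a c} (p : a ≢ b) (q : b ≢ c) → P a c p q
    reindex P P-punchIn p q = transport (Fin.punchIn-punchOut (p ∘ sym)) (Fin.punchIn-punchOut q) p q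
      where
      transport : ∀ {i j a c} → punchIn b i ≡ a → punchIn b j ≡ c → .(p : a ≢ b) .(q : b ≢ c) → P a c p q
      transport refl refl _ _ = P-punchIn _ _

    -- The diagonal entry in the row of a is the edge ab - ba, and that in the column of c is cb -
    -- bc; κ tells whether rows or columns are constant.
    uniform : Σ[ κ ∈ Bool ] ∀ {a c} (p : a ≢ b) (q : b ≢ c) →
      precedes a b c p q ≡ (if κ then T a b p else T c b (q ∘ sym))
    uniform with row-or-column M bipartite
    ... | inj₁ rows    = true , reindex (λ a c p q → precedes a b c p q ≡ T a b p)
      λ i j → trans (rows i j) (sym (T≡precedes (other i ∘ sym)))
    ... | inj₂ columns = false , reindex (λ a c p q → precedes a b c p q ≡ T c b (q ∘ sym))
      λ i j → trans (columns i j) (sym (T≡precedes (other j ∘ sym)))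

  κ : Fin 4 → Bool
  κ b = proj₁ (uniform b)

  -- Spelled out because `T` takes proofs of distinctness; at numerals it computes to
  -- `BalancedSquare` for a `tournament`.
  square : ∀ {a b c d} (ab : a ≢ b) (bc : b ≢ c) (cd : c ≢ d) (da : d ≢ a) (ac : a ≢ c) (bd : b ≢ d) →
    Balanced (if κ b then T a b ab else T c b (bc ∘ sym)) (if κ c then T b c bc else T d c (cd ∘ sym))
             (if κ d then T c d cd else T a d (da ∘ sym)) (if κ a then T d a da else T b a (ab ∘ sym))
  square {a} {b} {c} {d} ab bc cd da ac bd = transport
    (proj₂ (uniform b) ab bc) (proj₂ (uniform c) bc cd) (proj₂ (uniform d) cd da) (proj₂ (uniform a) da ab)
    (cycle-balanced (cycle (consecutive ab bc) (consecutive bc cd) (consecutive cd da) (consecutive da ab)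
      (ac ∘ proj₁ ∘ arc-injective ab cd) (bd ∘ proj₁ ∘ arc-injective bc da)
      ([ bc , da ]′ ∘ consecutive⁻ ab cd) ([ cd , ab ]′ ∘ consecutive⁻ bc da)))
    where
    transport : ∀ {p p′ q q′ r r′ s s′} → p ≡ p′ → q ≡ q′ → r ≡ r′ → s ≡ s′ → Balanced p q r s → Balanced p′ q′ r′ s′
    transport refl refl refl refl balanced = balanced

  contradictory : ⊥
  contradictory = unbalanced (κ 0F ∷ κ 1F ∷ κ 2F ∷ κ 3F ∷ [])
    (T 0F 1F (λ ()) ∷ T 0F 2F (λ ()) ∷ T 0F 3F (λ ()) ∷ T 1F 2F (λ ()) ∷ T 1F 3F (λ ()) ∷ T 2F 3F (λ ()) ∷ [])
    ( square (λ ()) (λ ()) (λ ()) (λ ()) (λ ()) (λ ())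
    , square (λ ()) (λ ()) (λ ()) (λ ()) (λ ()) (λ ())
    , square (λ ()) (λ ()) (λ ()) (λ ()) (λ ()) (λ ())
    , square (λ ()) (λ ()) (λ ()) (λ ()) (λ ()) (λ ())
    , square (λ ()) (λ ()) (λ ()) (λ ()) (λ ()) (λ ())
    , square (λ ()) (λ ()) (λ ()) (λ ()) (λ ()) (λ ()) )

-- The letters 0, m, 2m, 3m

module FourLetters (m : ℕ) {k : ℕ} .{{_ : NonZero m}} (k≥3*m+1 : k ≥ 3 * m + 1) where

  open SimpleGraph (Sₘ m 2 k)

  multiple<k : ∀ a → toℕ {4} a * m < k
  multiple<k a = begin-strict
    toℕ a * m  ≤⟨ ℕ.*-monoˡ-≤ m (Fin.toℕ≤pred[n] a) ⟩
    3 * m      <⟨ ℕ.m<m+n (3 * m) ℕ.0<1+n ⟩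
    3 * m + 1  ≤⟨ k≥3*m+1 ⟩
    k          ∎
    where open ℕ.≤-Reasoning

  multiple : Fin 4 → Fin k
  multiple a = fromℕ< (multiple<k a)

  toℕ-multiple : ∀ a → toℕ (multiple a) ≡ toℕ a * m
  toℕ-multiple a = Fin.toℕ-fromℕ< (multiple<k a)

  multiple-injective : ∀ {a b} → multiple a ≡ multiple b → a ≡ b
  multiple-injective {a} {b} eq = Fin.toℕ-injective (ℕ.*-cancelʳ-≡ (toℕ a) (toℕ b) m
    (trans (sym (toℕ-multiple a)) (trans (cong toℕ eq) (toℕ-multiple b))))

  multiples-spread : ∀ {a b} → a ≢ b → m ≤ ∣ toℕ (multiple a) - toℕ (multiple b) ∣
  multiples-spread {a} {b} a≢b = begin
    m                                        ≡⟨ ℕ.*-identityˡ m ⟨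
    1 * m                                    ≤⟨ ℕ.*-monoˡ-≤ m (ℕ.n≢0⇒n>0 (a≢b ∘ Fin.toℕ-injective ∘ ℕ.∣m-n∣≡0⇒m≡n)) ⟩
    ∣ toℕ a - toℕ b ∣ * m                    ≡⟨ ℕ.*-distribʳ-∣-∣ m (toℕ a) (toℕ b) ⟩
    ∣ toℕ a * m - toℕ b * m ∣                ≡⟨ cong₂ ∣_-_∣ (toℕ-multiple a) (toℕ-multiple b) ⟨
    ∣ toℕ (multiple a) - toℕ (multiple b) ∣  ∎
    where open ℕ.≤-Reasoning

  arc : (a b : Fin 4) → .(a ≢ b) → Vertex
  arc a b a≢b = (multiple a ∷ multiple b ∷ []) , irr (multiples-spread a≢b ∷ [-])

  arc-injective : ∀ {a b c d} .(p : a ≢ b) .(q : c ≢ d) → arc a b p ≡ arc c d q → a ≡ c × b ≡ d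
  arc-injective _ _ eq =
    multiple-injective (Vec.∷-injectiveˡ (cong value eq)) ,
    multiple-injective (Vec.∷-injectiveˡ (Vec.∷-injectiveʳ (cong value eq)))

  consecutive : ∀ {a b c} (p : a ≢ b) (q : b ≢ c) → arc a b p ~ arc b c q
  consecutive p q =
    (λ eq → p (multiple-injective (Vec.∷-injectiveˡ eq))) ,
    inj₁ λ { 0F 0F () ; 0F 1F _ → refl ; 1F 0F () ; 1F 1F () }

  consecutive⁻ : ∀ {a b c d} .(p : a ≢ b) .(q : c ≢ d) → arc a b p ~ arc c d q → b ≡ c ⊎ d ≡ a
  consecutive⁻ _ _ (_ , inj₁ shift) = inj₁ (multiple-injective (shift 0F 1F refl))
  consecutive⁻ _ _ (_ , inj₂ shift) = inj₂ (multiple-injective (shift 0F 1F refl))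

  not-representable : ¬ WordRepresentable (Sₘ m 2 k)
  not-representable representation = K₄.contradictory (Sₘ m 2 k) representation
    arc arc-injective consecutive consecutive⁻

theorem5 : (m n k : ℕ) → .{{_ : NonZero m}} → .{{_ : NonZero n}} → .{{_ : NonZero k}} →
    ( ( (n ≡ 2 ⊎ n ≡ 3 ⊎ n ≡ 4) → k ≤ (n + 1) * m → WordRepresentable (Sₘ m n k) )
    × ( k ≥ 3 * m + 1 → ¬ WordRepresentable (Sₘ m 2 k) ) )
    × ( n ≥ 5 → k ≤ 2 * m * n → WordRepresentable (Sₘ m n k) )
theorem5 m n k = (small , FourLetters.not-representable m) , large
  where
  small : n ≡ 2 ⊎ n ≡ 3 ⊎ n ≡ 4 → k ≤ (n + 1) * m → WordRepresentable (Sₘ m n k)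
  small (inj₁ refl)        k≤3m = colourable⇒word-representable m k≤3m colourable₂
  small (inj₂ (inj₁ refl)) k≤4m = colourable⇒word-representable m k≤4m colourable₃
  -- `colourable₄` has six letters, so the bound 5m is relaxed to 6m.
  small (inj₂ (inj₂ refl)) k≤5m = colourable⇒word-representable m (ℕ.m≤n⇒m≤o+n m k≤5m) colourable₄

  double : ∀ m d → 2 * m * (5 + d) ≡ (10 + d * 2) * m
  double = solve-∀

  large : n ≥ 5 → k ≤ 2 * m * n → WordRepresentable (Sₘ m n k)
  large n≥5 k≤2mn with d , refl ← ℕ.m≤n⇒∃[o]m+o≡n n≥5 =
    colourable⇒word-representable m (ℕ.≤-trans k≤2mn (ℕ.≤-reflexive (double m d))) (colourable₅₊ d)
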